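{- Let $X\subset[n]$ be nonempty, let $\mathcal{F}\subset\binom{X}{k}$, let $R,T\subset X$ be sets with $|R|,|T|<k$, $R\cap T=\emptyset$ and $r:=\min X\in R$, and let $i\in X\setminus R$. Consider the following properties. (P1) For all disjoint $U,V\subset X$ with $|U|=|V|$ and $r\in U$, if $S_{U,V}(\mathcal{F})\ne\mathcal{F}$, then $|V|\ge|R|$. (P2) There exists $F\in\mathcal{F}$ with $R\cap F=\emptyset$. (P3) $R$ is non-full in $\mathcal{F}$. (P4) $R\cup\{i\}$ is non-full in $\mathcal{F}$. (P5) There exists $F\in\mathcal{F}$ with $R\cap F=\emptyset$ and $i\in F$. (P6) There exists $F\in\mathcal{F}$ with $(R\cup T)\cap F=\emptyset$. (P7) Every $F\in\mathcal{F}$ with $(R\cup T)\cap F=\emptyset$ satisfies $i\in F$. Then: (i) If (P1)--(P3) hold, then there exists a pair $(U,V)$ satisfying $\mathbf{Q}$ for $\mathcal{F}$ with $R\subset U$. (ii) If (P1)--(P5) hold, then there exists a pair $(U,V)$ satisfying $\mathbf{Q}$ for $\mathcal{F}$ with $R\subset U$ and $i\notin V$. (iii) If (P1)--(P3) and (P6) hold, then there exists a pair $(U,V)$ satisfying $\mathbf{Q}$ for $\mathcal{F}$ with $T\cap V=\emptyset$ and $R\subset U$. (iv) If (P1)--(P4) and (P6)--(P7) hold, then there exists a pair $(U,V)$ satisfying $\mathbf{Q}$ for $\mathcal{F}$ with $(T\cup\{i\})\cap V=\emptyset$ and $R\subset U$.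
   Context: $[n]=\{1,\dots,n\}$; $\binom{X}{k}$ is the family of all $k$-subsets of $X$. Lexicographic order: for sets $A,B$ of integers write $A\prec B$ if either $B\subset A$ or $\min(A\setminus B)<\min(B\setminus A)$. For a $k$-set $S\subset X$, $i_{\mathrm{lex}}(S)$ is its position in the lexicographic order on $\binom{X}{k}$. Shift: for disjoint sets $U,V$ with $|U|=|V|$, put $S_{U,V}(F)=(F\setminus V)\cup U$ if $F\cap(U\cup V)=V$, and $S_{U,V}(F)=F$ otherwise; for a family, $S_{U,V}(\mathcal{F})=\{S_{U,V}(F):F\in\mathcal{F}\}\cup\{F\in\mathcal{F}:S_{U,V}(F)\in\mathcal{F}\}$. Property $\mathbf{Q}$: let $U,V\subset X$ with $U\cap V=\emptyset$, $|U|=|V|$ and $U\prec V$. The pair $(U,V)$ satisfies $\mathbf{Q}$ for $\mathcal{F}$ if $\sum_{S\in S_{U,V}(\mathcal{F})}i_{\mathrm{lex}}(S)<\sum_{S\in\mathcal{F}}i_{\mathrm{lex}}(S)$ and for every $V'\subsetneq V$ there exists $U'\subsetneq U$ such that $U'\prec V'$, $|U'|=|V'|$ and $S_{U',V'}(\mathcal{F})=\mathcal{F}$. Non-full: for $C\subset X$ with $|C|\le k$, let $\mathcal{E}^k_C=\{C\cup D: D\subset\{x\in X:x>\max C\},\ |D|=k-|C|\}$ (with $\max\emptyset=0$). The set $C$ is non-full in $\mathcal{F}$ if $\mathcal{E}^k_C\setminus\mathcal{F}\ne\emptyset$. -}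

module Defs where

open import Data.Bool.Base using (Bool; true; if_then_else_; _∧_; _∨_)
import Data.Bool.Properties as Bool
open import Data.Fin.Base as Fin using (Fin; toℕ)
import Data.Fin.Properties as Fin
open import Data.Fin.Subset using (Subset; _∈_; _⊆_; _⊂_; _∪_; _∩_; _─_; ⊥; ⁅_⁆; ∣_∣; inside; outside)
open import Data.Fin.Subset.Properties using (_∈?_; _⊆?_; anySubset?)
open import Data.List.Base using (List; []; _∷_; _++_; map; filter; filterᵇ; length; allFin)
import Data.List.Extrema.Nat as Extrema
open import Data.Nat.Base using (ℕ; zero; suc; _+_; _<_; _≥_; _>_)
open import Data.Nat.ListAction using (sum)
import Data.Nat.Properties as ℕ
open import Data.Product.Base using (_×_; ∃-syntax)
open import Data.Sum.Base using (_⊎_)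
import Data.Vec.Base as Vec
import Data.Vec.Properties as Vec
open import Relation.Binary.Definitions using (Decidable; DecidableEquality)
open import Relation.Binary.PropositionalEquality using (_≡_)
open import Relation.Nullary.Decidable using (Dec; does; _×-dec_; _⊎-dec_; _→-dec_)
open import Relation.Nullary.Negation using (¬_)

private
  variable
    n : ℕ

-- A set of integers contained in [n] = {1,…,n} is a Subset n; the index
-- x : Fin n stands for the integer label x.
label : Fin n → ℕ
label x = suc (toℕ x)

_≟ˢ_ : DecidableEquality (Subset n)
_≟ˢ_ = Vec.≡-dec Bool._≟_

IsMin : Fin n → Subset n → Set
IsMin a A = a ∈ A × (∀ x → x ∈ A → a Fin.≤ x)

isMin? : (a : Fin n) (A : Subset n) → Dec (IsMin a A)
isMin? a A = a ∈? A ×-dec Fin.all? (λ x → x ∈? A →-dec a Fin.≤? x)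

-- The convention max ∅ = 0 is meaningful because labels start at 1.
maxLabel : Subset n → ℕ
maxLabel {n} C = Extrema.max 0 (map label (filter (_∈? C) (allFin n)))

infix 4 _≺_ _≺?_

-- The inclusion B ⊂ A is read as non-strict, so A ≺ A holds.  (Property Q
-- needs ∅ ≺ ∅, for V' = ∅.)  If A ∖ B is empty and B ⊈ A, then neither
-- alternative holds.
_≺_ : Subset n → Subset n → Set
A ≺ B = B ⊆ A ⊎ (∃[ a ] ∃[ b ] IsMin a (A ─ B) × IsMin b (B ─ A) × a Fin.< b)

_≺?_ : Decidable (_≺_ {n})
A ≺? B = B ⊆? A ⊎-dec
  Fin.any? (λ a → Fin.any? (λ b → isMin? a (A ─ B) ×-dec isMin? b (B ─ A) ×-dec a Fin.<? b))

allSubsets : ∀ n → List (Subset n)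
allSubsets zero    = Vec.[] ∷ []
allSubsets (suc n) = map (inside Vec.∷_) (allSubsets n) ++ map (outside Vec.∷_) (allSubsets n)

Binom : Subset n → ℕ → Subset n → Set
Binom X k S = S ⊆ X × ∣ S ∣ ≡ k

binom? : (X : Subset n) (k : ℕ) (S : Subset n) → Dec (Binom X k S)
binom? X k S = S ⊆? X ×-dec ∣ S ∣ ℕ.≟ k

-- Positions are counted from 1: S itself is among the sets counted.
ilex : Subset n → ℕ → Subset n → ℕ
ilex {n} X k S = length (filter (λ A → binom? X k A ×-dec A ≺? S) (allSubsets n))

-- A family of subsets of [n], given by its characteristic function.
Family : ℕ → Set
Family n = Subset n → Bool

infix 4 _∈ᶠ_ _∉ᶠ_ _≐_ _⊆ᶠ_

_∈ᶠ_ _∉ᶠ_ : Subset n → Family n → Set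
S ∈ᶠ 𝓕 = 𝓕 S ≡ true
S ∉ᶠ 𝓕 = ¬ (S ∈ᶠ 𝓕)

_≐_ : Family n → Family n → Set
𝓕 ≐ 𝓖 = ∀ S → 𝓕 S ≡ 𝓖 S

_⊆ᶠ_ : Family n → (Subset n → Set) → Set
𝓕 ⊆ᶠ P = ∀ S → S ∈ᶠ 𝓕 → P S

sumIlex : Subset n → ℕ → Family n → ℕ
sumIlex {n} X k 𝓕 = sum (map (ilex X k) (filterᵇ 𝓕 (allSubsets n)))

shift : (U V : Subset n) → Subset n → Subset n
shift U V F = if does ((F ∩ (U ∪ V)) ≟ˢ V) then (F ─ V) ∪ U else F

-- The two disjuncts are the two parts of the union defining S_{U,V}(𝓕).
shiftFamily : (U V : Subset n) → Family n → Family n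
shiftFamily U V 𝓕 G =
  does (anySubset? (λ F → (𝓕 F Bool.≟ true) ×-dec (shift U V F ≟ˢ G)))
  ∨ (𝓕 G ∧ 𝓕 (shift U V G))

record PropertyQ (X : Subset n) (k : ℕ) (𝓕 : Family n) (U V : Subset n) : Set where
  field
    U⊆X       : U ⊆ X
    V⊆X       : V ⊆ X
    disjoint  : U ∩ V ≡ ⊥
    ∣U∣≡∣V∣   : ∣ U ∣ ≡ ∣ V ∣
    U≺V       : U ≺ V
    decreases : sumIlex X k (shiftFamily U V 𝓕) < sumIlex X k 𝓕
    stable    : ∀ V′ → V′ ⊂ V →
                ∃[ U′ ] U′ ⊂ U × U′ ≺ V′ × ∣ U′ ∣ ≡ ∣ V′ ∣ × shiftFamily U′ V′ 𝓕 ≐ 𝓕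

-- The condition |D| = k - |C| is written without truncated subtraction.
𝓔 : Subset n → ℕ → Subset n → Subset n → Set
𝓔 X k C S =
  ∃[ D ] (∀ x → x ∈ D → x ∈ X × label x > maxLabel C) × ∣ C ∣ + ∣ D ∣ ≡ k × S ≡ C ∪ D

NonFull : Subset n → ℕ → Family n → Subset n → Set
NonFull X k 𝓕 C = ∃[ S ] 𝓔 X k C S × S ∉ᶠ 𝓕

P1 : Subset n → Family n → Fin n → Subset n → Set
P1 X 𝓕 r R = ∀ U V → U ⊆ X → V ⊆ X → U ∩ V ≡ ⊥ → ∣ U ∣ ≡ ∣ V ∣ → r ∈ U →
  ¬ (shiftFamily U V 𝓕 ≐ 𝓕) → ∣ V ∣ ≥ ∣ R ∣

P2 : Family n → Subset n → Set
P2 𝓕 R = ∃[ F ] F ∈ᶠ 𝓕 × R ∩ F ≡ ⊥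

P3 : Subset n → ℕ → Family n → Subset n → Set
P3 X k 𝓕 R = NonFull X k 𝓕 R

P4 : Subset n → ℕ → Family n → Subset n → Fin n → Set
P4 X k 𝓕 R i = NonFull X k 𝓕 (R ∪ ⁅ i ⁆)

P5 : Family n → Subset n → Fin n → Set
P5 𝓕 R i = ∃[ F ] F ∈ᶠ 𝓕 × R ∩ F ≡ ⊥ × i ∈ F

P6 : Family n → Subset n → Subset n → Set
P6 𝓕 R T = ∃[ F ] F ∈ᶠ 𝓕 × (R ∪ T) ∩ F ≡ ⊥

P7 : Family n → Subset n → Subset n → Fin n → Set
P7 𝓕 R T i = ∀ F → F ∈ᶠ 𝓕 → (R ∪ T) ∩ F ≡ ⊥ → i ∈ F

{-# OPTIONS --safe #-}

-- All four parts reduce to one statement.  Let S ∉ 𝓕 be a k-set with R ⊆ S and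
-- F ∈ 𝓕 with R ∩ F = ∅.  The shift by (S ∖ F, F ∖ S) sends F to S, so it moves
-- 𝓕.  Among the pairs (U, V) inside this one with R ⊆ U that move 𝓕, take one
-- with |U| minimal.  For V′ ⊊ V with |V′| ≥ |R|, any U′ with R ⊆ U′ ⊊ U and
-- |U′| = |V′| leaves 𝓕 fixed by minimality; for |V′| < |R|, any U′ ∋ r does,
-- by (P1).  Since r = min X ∈ U, every set that is really shifted acquires r and
-- moves forward in the lexicographic order, so the sum of positions drops.
module Submission where

open import Defs
open import Data.Bool.Base using (true; if_then_else_)
import Data.Bool.Properties as Bool
open import Data.Fin.Base using (Fin; zero; suc)
import Data.Fin.Properties as Fin
open import Data.Fin.Subset using (Subset; Nonempty; _∈_; _∉_; _⊆_; _⊂_; _∪_; _∩_; _─_; ⊥; ⁅_⁆; ∣_∣; inside; outside)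
open import Data.Fin.Subset.Properties
open import Data.List.Base using (List; []; _∷_; _++_; map; filter; filterᵇ; length)
open import Data.List.Extrema.Nat using (xs≤max)
import Data.List.Membership.Propositional as List
open import Data.List.Membership.Propositional.Properties
open import Data.List.Properties using (length-++; map-++; map-∘)
open import Data.List.Relation.Binary.Permutation.Propositional using (_↭_; ↭-refl; ↭-trans; prep)
open import Data.List.Relation.Binary.Permutation.Propositional.Properties using (∈-resp-↭; ↭-length) renaming (map⁺ to ↭-map⁺; shift to ↭-shift)
import Data.List.Relation.Binary.Subset.Propositional as List
open import Data.List.Relation.Unary.All as All using ([]; _∷_)
open import Data.List.Relation.Unary.Any using (here; there)
open import Data.List.Relation.Unary.Unique.Propositional using (Unique; []; _∷_)
import Data.List.Relation.Unary.Unique.Propositional.Properties as Unique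
open import Data.Nat.Base using (ℕ; zero; suc; _+_; _≤_; _<_; z≤n; s≤s)
open import Data.Nat.Induction using (Acc; acc; <-wellFounded)
open import Data.Nat.ListAction using (sum)
open import Data.Nat.ListAction.Properties using (sum-++; sum-↭)
import Data.Nat.Properties as ℕ
open import Data.Product.Base using (_×_; _,_; proj₁; proj₂; ∃-syntax)
open import Data.Sum.Base using (_⊎_; inj₁; inj₂; [_,_]′)
import Data.Vec.Base as Vec
import Data.Vec.Properties as Vec
open import Function.Base using (_∘_)
open import Function.Bundles using (Equivalence)
open import Relation.Binary.PropositionalEquality
open import Relation.Nullary.Decidable using (Dec; yes; no; _×-dec_; ¬?)
open import Relation.Nullary.Negation using (¬_; contradiction)

private
  variable
    n : ℕ
    A : Set

-- Sums and lengths over lists without repetition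

-- Induction on `xs`: an occurrence of the head in `ys` is pulled to the front, and the tail embeds
-- in the rest because it does not contain the head again. The complement `zs` serves both
-- comparisons that follow, of sums and of lengths.
Unique∧⊆⇒↭-++ : {xs ys : List A} → Unique xs → xs List.⊆ ys → ∃[ zs ] ys ↭ xs ++ zs
Unique∧⊆⇒↭-++ {ys = ys} [] _ = ys , ↭-refl
Unique∧⊆⇒↭-++ {xs = x ∷ xs} (x∉xs ∷ xs!) xs⊆ys
  with ys₁ , ys₂ , refl ← ∈-∃++ (xs⊆ys (here refl))
  = let zs , p = Unique∧⊆⇒↭-++ xs! xs⊆ in zs , ↭-trans (↭-shift x ys₁ ys₂) (prep x p)
  where
  xs⊆ : xs List.⊆ ys₁ ++ ys₂
  xs⊆ y∈xs with ∈-resp-↭ (↭-shift x ys₁ ys₂) (xs⊆ys (there y∈xs))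
  ... | here y≡x = contradiction (sym y≡x) (All.lookup x∉xs y∈xs)
  ... | there y∈ = y∈

sum-map-⊆ : (w : A → ℕ) {xs ys : List A} → Unique xs → xs List.⊆ ys →
  sum (map w xs) ≤ sum (map w ys)
sum-map-⊆ w {xs} {ys} xs! xs⊆ys with zs , p ← Unique∧⊆⇒↭-++ xs! xs⊆ys = begin
  sum (map w xs)                   ≤⟨ ℕ.m≤m+n _ _ ⟩
  sum (map w xs) + sum (map w zs)  ≡⟨ sum-++ (map w xs) _ ⟨
  sum (map w xs ++ map w zs)       ≡⟨ cong sum (map-++ w xs zs) ⟨
  sum (map w (xs ++ zs))           ≡⟨ sum-↭ (↭-map⁺ w p) ⟨
  sum (map w ys)                   ∎
  where open ℕ.≤-Reasoning

length-⊆ : {xs ys : List A} → Unique xs → xs List.⊆ ys → length xs ≤ length ys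
length-⊆ {xs = xs} {ys} xs! xs⊆ys with zs , p ← Unique∧⊆⇒↭-++ xs! xs⊆ys = begin
  length xs              ≤⟨ ℕ.m≤m+n _ _ ⟩
  length xs + length zs  ≡⟨ length-++ xs ⟨
  length (xs ++ zs)      ≡⟨ ↭-length p ⟨
  length ys              ∎
  where open ℕ.≤-Reasoning

sum-map-mono-≤ : {f g : A → ℕ} (xs : List A) → (∀ {x} → x List.∈ xs → f x ≤ g x) →
  sum (map f xs) ≤ sum (map g xs)
sum-map-mono-≤ []       _   = z≤n
sum-map-mono-≤ (x ∷ xs) f≤g = ℕ.+-mono-≤ (f≤g (here refl)) (sum-map-mono-≤ xs (f≤g ∘ there))

sum-map-mono-< : {f g : A → ℕ} {x : A} (xs : List A) → (∀ {x} → x List.∈ xs → f x ≤ g x) →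
  x List.∈ xs → f x < g x → sum (map f xs) < sum (map g xs)
sum-map-mono-< (x ∷ xs) f≤g (here refl)  fx<gx = ℕ.+-mono-<-≤ fx<gx (sum-map-mono-≤ xs (f≤g ∘ there))
sum-map-mono-< (x ∷ xs) f≤g (there x∈xs) fx<gx =
  ℕ.+-mono-≤-< (f≤g (here refl)) (sum-map-mono-< xs (f≤g ∘ there) x∈xs fx<gx)

-- Enumeration of all subsets

∈-allSubsets : (S : Subset n) → S List.∈ allSubsets n
∈-allSubsets Vec.[]            = here refl
∈-allSubsets (inside  Vec.∷ S) = ∈-++⁺ˡ (∈-map⁺ _ (∈-allSubsets S))
∈-allSubsets (outside Vec.∷ S) = ∈-++⁺ʳ (map (inside Vec.∷_) (allSubsets _)) (∈-map⁺ _ (∈-allSubsets S))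

allSubsets-unique : ∀ n → Unique (allSubsets n)
allSubsets-unique zero    = [] ∷ []
allSubsets-unique (suc n) = Unique.++⁺
  (Unique.map⁺ Vec.∷-injectiveʳ (allSubsets-unique n))
  (Unique.map⁺ Vec.∷-injectiveʳ (allSubsets-unique n))
  disjoint
  where
  disjoint : ∀ {S} → ¬ (S List.∈ map (inside Vec.∷_) (allSubsets n) × S List.∈ map (outside Vec.∷_) (allSubsets n))
  disjoint (S∈₁ , S∈₂) with ∈-map⁻ _ S∈₁ | ∈-map⁻ _ S∈₂
  ... | _ , _ , refl | _ , _ , ()

-- Set algebra and cardinalities

∉-∩⊥ : {p q : Subset n} {x : Fin n} → p ∩ q ≡ ⊥ → x ∈ p → x ∉ q
∉-∩⊥ p∩q≡⊥ x∈p x∈q = ∉⊥ (subst (_ ∈_) p∩q≡⊥ (x∈p∩q⁺ (x∈p , x∈q)))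

∩≡⊥ : {p q : Subset n} → (∀ {x} → x ∈ p → x ∉ q) → p ∩ q ≡ ⊥
∩≡⊥ {p = p} {q} p∩q=∅ = Empty-unique λ (x , x∈p∩q) →
  let x∈p , x∈q = x∈p∩q⁻ p q x∈p∩q in p∩q=∅ x∈p x∈q

x∈p─q⇒x∉q : (p q : Subset n) {x : Fin n} → x ∈ p ─ q → x ∉ q
x∈p─q⇒x∉q (inside Vec.∷ p) (outside Vec.∷ q) Vec.here ()
x∈p─q⇒x∉q (_ Vec.∷ p) (_ Vec.∷ q) (Vec.there x∈p─q) (Vec.there x∈q) = x∈p─q⇒x∉q p q x∈p─q x∈q

∣p∪q∣+∣p∩q∣≡∣p∣+∣q∣ : (p q : Subset n) → ∣ p ∪ q ∣ + ∣ p ∩ q ∣ ≡ ∣ p ∣ + ∣ q ∣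
∣p∪q∣+∣p∩q∣≡∣p∣+∣q∣ Vec.[] Vec.[] = refl
∣p∪q∣+∣p∩q∣≡∣p∣+∣q∣ (inside Vec.∷ p) (inside Vec.∷ q) = cong suc (begin
  ∣ p ∪ q ∣ + suc ∣ p ∩ q ∣    ≡⟨ ℕ.+-suc _ _ ⟩
  suc (∣ p ∪ q ∣ + ∣ p ∩ q ∣)  ≡⟨ cong suc (∣p∪q∣+∣p∩q∣≡∣p∣+∣q∣ p q) ⟩
  suc (∣ p ∣ + ∣ q ∣)          ≡⟨ ℕ.+-suc _ _ ⟨
  ∣ p ∣ + suc ∣ q ∣            ∎)
  where open ≡-Reasoning
∣p∪q∣+∣p∩q∣≡∣p∣+∣q∣ (inside Vec.∷ p) (outside Vec.∷ q) = cong suc (∣p∪q∣+∣p∩q∣≡∣p∣+∣q∣ p q)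
∣p∪q∣+∣p∩q∣≡∣p∣+∣q∣ (outside Vec.∷ p) (inside Vec.∷ q) =
  trans (cong suc (∣p∪q∣+∣p∩q∣≡∣p∣+∣q∣ p q)) (sym (ℕ.+-suc _ _))
∣p∪q∣+∣p∩q∣≡∣p∣+∣q∣ (outside Vec.∷ p) (outside Vec.∷ q) = ∣p∪q∣+∣p∩q∣≡∣p∣+∣q∣ p q

∣p∪q∣≡∣p∣+∣q∣ : (p q : Subset n) → p ∩ q ≡ ⊥ → ∣ p ∪ q ∣ ≡ ∣ p ∣ + ∣ q ∣
∣p∪q∣≡∣p∣+∣q∣ {n} p q p∩q≡⊥ = begin
  ∣ p ∪ q ∣              ≡⟨ ℕ.+-identityʳ _ ⟨
  ∣ p ∪ q ∣ + 0          ≡⟨ cong (∣ p ∪ q ∣ +_) (trans (cong ∣_∣ p∩q≡⊥) (∣⊥∣≡0 n)) ⟨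
  ∣ p ∪ q ∣ + ∣ p ∩ q ∣  ≡⟨ ∣p∪q∣+∣p∩q∣≡∣p∣+∣q∣ p q ⟩
  ∣ p ∣ + ∣ q ∣          ∎
  where open ≡-Reasoning

p─q∪p∩q≡p : (p q : Subset n) → (p ─ q) ∪ (p ∩ q) ≡ p
p─q∪p∩q≡p Vec.[] Vec.[] = refl
p─q∪p∩q≡p (inside  Vec.∷ p) (inside  Vec.∷ q) = cong (inside  Vec.∷_) (p─q∪p∩q≡p p q)
p─q∪p∩q≡p (inside  Vec.∷ p) (outside Vec.∷ q) = cong (inside  Vec.∷_) (p─q∪p∩q≡p p q)
p─q∪p∩q≡p (outside Vec.∷ p) (inside  Vec.∷ q) = cong (outside Vec.∷_) (p─q∪p∩q≡p p q)
p─q∪p∩q≡p (outside Vec.∷ p) (outside Vec.∷ q) = cong (outside Vec.∷_) (p─q∪p∩q≡p p q)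

∣p─q∣+∣p∩q∣≡∣p∣ : (p q : Subset n) → ∣ p ─ q ∣ + ∣ p ∩ q ∣ ≡ ∣ p ∣
∣p─q∣+∣p∩q∣≡∣p∣ p q = trans (sym (∣p∪q∣≡∣p∣+∣q∣ (p ─ q) (p ∩ q) disjoint)) (cong ∣_∣ (p─q∪p∩q≡p p q))
  where
  disjoint : (p ─ q) ∩ (p ∩ q) ≡ ⊥
  disjoint = ∩≡⊥ λ x∈p─q x∈p∩q → x∈p─q⇒x∉q p q x∈p─q (p∩q⊆q p q x∈p∩q)

-- Both differences arise from sets of equal size by deleting the same intersection.
∣p∣≡∣q∣⇒∣p─q∣≡∣q─p∣ : (p q : Subset n) → ∣ p ∣ ≡ ∣ q ∣ → ∣ p ─ q ∣ ≡ ∣ q ─ p ∣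
∣p∣≡∣q∣⇒∣p─q∣≡∣q─p∣ p q ∣p∣≡∣q∣ = ℕ.+-cancelʳ-≡ ∣ p ∩ q ∣ _ _ (begin
  ∣ p ─ q ∣ + ∣ p ∩ q ∣  ≡⟨ ∣p─q∣+∣p∩q∣≡∣p∣ p q ⟩
  ∣ p ∣                  ≡⟨ ∣p∣≡∣q∣ ⟩
  ∣ q ∣                  ≡⟨ ∣p─q∣+∣p∩q∣≡∣p∣ q p ⟨
  ∣ q ─ p ∣ + ∣ q ∩ p ∣  ≡⟨ cong (λ s → ∣ q ─ p ∣ + ∣ s ∣) (∩-comm q p) ⟩
  ∣ q ─ p ∣ + ∣ p ∩ q ∣  ∎)
  where open ≡-Reasoning

⊆∧∣∣<⇒⊂ : {p q : Subset n} → p ⊆ q → ∣ p ∣ < ∣ q ∣ → p ⊂ q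
⊆∧∣∣<⇒⊂ {p = p} {q} p⊆q ∣p∣<∣q∣ with nonempty? (q ─ p)
... | yes (x , x∈q─p) = p⊆q , x , p─q⊆p q p x∈q─p , x∈p─q⇒x∉q q p x∈q─p
... | no  q─p=∅       = contradiction (p⊆q⇒∣p∣≤∣q∣ q⊆p) (ℕ.<⇒≱ ∣p∣<∣q∣)
  where
  q⊆p : q ⊆ p
  q⊆p {x} x∈q with x ∈? p
  ... | yes x∈p = x∈p
  ... | no  x∉p = contradiction (x , x∈p∧x∉q⇒x∈p─q x∈q x∉p) q─p=∅

-- Greedy choice: an element of `q` outside `p` is skipped as long as the later elements of `q` can
-- still supply `m` elements.
intermediate-subset : (p q : Subset n) (m : ℕ) → p ⊆ q → ∣ p ∣ ≤ m → m ≤ ∣ q ∣ →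
  ∃[ s ] p ⊆ s × s ⊆ q × ∣ s ∣ ≡ m
intermediate-subset Vec.[] Vec.[] zero _ _ _ = Vec.[] , (λ ()) , (λ ()) , refl
intermediate-subset (inside Vec.∷ p) (outside Vec.∷ q) m p⊆q _ _ with () ← p⊆q Vec.here
intermediate-subset (inside Vec.∷ p) (inside Vec.∷ q) (suc m) p⊆q (s≤s p≤m) (s≤s m≤q)
  with s , p⊆s , s⊆q , ∣s∣≡m ← intermediate-subset p q m (drop-∷-⊆ p⊆q) p≤m m≤q
  = inside Vec.∷ s , s⊆s p⊆s , s⊆s s⊆q , cong suc ∣s∣≡m
intermediate-subset (outside Vec.∷ p) (outside Vec.∷ q) m p⊆q p≤m m≤q
  with s , p⊆s , s⊆q , ∣s∣≡m ← intermediate-subset p q m (drop-∷-⊆ p⊆q) p≤m m≤q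
  = outside Vec.∷ s , s⊆s p⊆s , s⊆s s⊆q , ∣s∣≡m
intermediate-subset (outside Vec.∷ p) (inside Vec.∷ q) m p⊆q p≤m m≤1+q with m ℕ.≤? ∣ q ∣
... | yes m≤q
  with s , p⊆s , s⊆q , ∣s∣≡m ← intermediate-subset p q m (drop-∷-⊆ p⊆q) p≤m m≤q
  = outside Vec.∷ s , s⊆s p⊆s , out⊆ s⊆q , ∣s∣≡m
-- Now `m` is exactly the number of all remaining elements, the current one included, so everything
-- is taken.
... | no  m≰q = inside Vec.∷ q , p⊆q , ⊆-refl , ℕ.≤-antisym (ℕ.≰⇒> m≰q) m≤1+q

-- Least elements, maxima and non-full sets

least : (A : Subset n) → Nonempty A → ∃[ a ] IsMin a A
least (inside  Vec.∷ A) _ = zero , Vec.here , λ _ _ → z≤n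
least (outside Vec.∷ A) (suc x , Vec.there x∈A) with a , a∈A , a≤ ← least A (x , x∈A)
  = suc a , Vec.there a∈A , λ { (suc y) (Vec.there y∈A) → s≤s (a≤ y y∈A) }

∈⇒label≤maxLabel : {C : Subset n} {x : Fin n} → x ∈ C → label x ≤ maxLabel C
∈⇒label≤maxLabel {C = C} {x} x∈C =
  All.lookup (xs≤max 0 _) (∈-map⁺ label (∈-filter⁺ (_∈? C) (∈-allFin x) x∈C))

-- The elements of `D` have labels beyond `maxLabel C`, so `C` and `D` are disjoint and their sizes
-- add up to `k`.
𝓔⇒Binom : {X C S : Subset n} {k : ℕ} → C ⊆ X → 𝓔 X k C S → C ⊆ S × Binom X k S
𝓔⇒Binom {X = X} {C} C⊆X (D , D> , ∣C∣+∣D∣≡k , refl) =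
  p⊆p∪q D ,
  (λ x∈C∪D → [ C⊆X , proj₁ ∘ D> _ ]′ (x∈p∪q⁻ C D x∈C∪D)) ,
  trans (∣p∪q∣≡∣p∣+∣q∣ C D C∩D≡⊥) ∣C∣+∣D∣≡k
  where
  C∩D≡⊥ : C ∩ D ≡ ⊥
  C∩D≡⊥ = ∩≡⊥ λ x∈C x∈D → ℕ.<⇒≱ (proj₂ (D> _ x∈D)) (∈⇒label≤maxLabel x∈C)

-- The lexicographic order and the minimum of `X`

-- As the minimum of `X`, `r` is the least element of `A ─ B`, and it lies strictly below anything
-- in `B ─ A` because `r ∉ B`. If `B ─ A` is empty, the inclusion alternative of `≺` applies.
≺-of-min : {X A B : Subset n} {r : Fin n} → IsMin r X → A ⊆ X → B ⊆ X → r ∈ A → r ∉ B → A ≺ B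
≺-of-min {A = A} {B} {r} (_ , r≤) A⊆X B⊆X r∈A r∉B with nonempty? (B ─ A)
... | yes B─A≠∅ with b , b∈B─A , b≤ ← least (B ─ A) B─A≠∅ =
  inj₂ (r , b , (x∈p∧x∉q⇒x∈p─q r∈A r∉B , λ x x∈A─B → r≤ x (A⊆X (p─q⊆p A B x∈A─B))) ,
        (b∈B─A , b≤) , Fin.≤∧≢⇒< (r≤ b (B⊆X b∈B)) λ { refl → r∉B b∈B })
  where b∈B = p─q⊆p B A b∈B─A
... | no  B─A=∅ = inj₁ B⊆A
  where
  B⊆A : B ⊆ A
  B⊆A {x} x∈B with x ∈? A
  ... | yes x∈A = x∈A
  ... | no  x∉A = contradiction (x , x∈p∧x∉q⇒x∈p─q x∈B x∉A) B─A=∅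

-- If `r` were in `B ─ A`, the least element of `B ─ A` would be at most `r`, and no element of `A`
-- could lie strictly below it.
≺⇒min∈ : {X A B : Subset n} {r : Fin n} → IsMin r X → A ⊆ X → A ≺ B → r ∈ B → r ∈ A
≺⇒min∈ _ _ (inj₁ B⊆A) r∈B = B⊆A r∈B
≺⇒min∈ {A = A} {B} {r} (_ , r≤) A⊆X (inj₂ (a , b , (a∈A─B , _) , (_ , b≤) , a<b)) r∈B with r ∈? A
... | yes r∈A = r∈A
... | no  r∉A = contradiction (ℕ.<-≤-trans a<b (b≤ r (x∈p∧x∉q⇒x∈p─q r∈B r∉A)))
                              (ℕ.≤⇒≯ (r≤ a (A⊆X (p─q⊆p A B a∈A─B))))

-- Every set counted for `S` contains `r` by `≺⇒min∈`, hence precedes `F` by `≺-of-min`. In addition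
-- `F` counts itself, and it is not among those sets since `r ∉ F`; this makes the inequality
-- strict.
ilex-<-of-min : {X S F : Subset n} {k : ℕ} {r : Fin n} → IsMin r X → Binom X k F →
  r ∈ S → r ∉ F → ilex X k S < ilex X k F
ilex-<-of-min {n} {X} {S} {F} {k} {r} r-min F∈binom@(F⊆X , _) r∈S r∉F =
  length-⊆ (All.tabulate F≢ ∷ Unique.filter⁺ _ (allSubsets-unique n)) before⊆
  where
  before? : ∀ S A → Dec (Binom X k A × A ≺ S)
  before? S A = binom? X k A ×-dec A ≺? S

  r∈ : ∀ {A} → A List.∈ filter (before? S) (allSubsets n) → r ∈ A
  r∈ A∈ with _ , (A⊆X , _) , A≺S ← ∈-filter⁻ (before? S) {xs = allSubsets n} A∈ = ≺⇒min∈ r-min A⊆X A≺S r∈S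

  F≢ : ∀ {A} → A List.∈ filter (before? S) (allSubsets n) → F ≢ A
  F≢ A∈ refl = r∉F (r∈ A∈)

  before⊆ : F ∷ filter (before? S) (allSubsets n) List.⊆ filter (before? F) (allSubsets n)
  before⊆ (here refl) = ∈-filter⁺ (before? F) (∈-allSubsets F) (F∈binom , inj₁ ⊆-refl)
  before⊆ (there A∈) with A∈all , A∈binom@(A⊆X , _) , _ ← ∈-filter⁻ (before? S) {xs = allSubsets n} A∈ =
    ∈-filter⁺ (before? F) A∈all (A∈binom , ≺-of-min r-min A⊆X F⊆X (r∈ A∈) r∉F)

-- Shifts and the families they move

-- A decidable form of instability with an explicit witness. The two lemmas `¬Moves⇒stable` and
-- `Moves⇒unstable` translate between it and equality of families, in which (P1) and property Q are
-- phrased.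
Moves : Family n → (U V : Subset n) → Set
Moves 𝓕 U V = ∃[ F ] F ∈ᶠ 𝓕 × shift U V F ∉ᶠ 𝓕

moves? : (𝓕 : Family n) (U V : Subset n) → Dec (Moves 𝓕 U V)
moves? 𝓕 U V = anySubset? λ F → (𝓕 F Bool.≟ true) ×-dec ¬? (𝓕 (shift U V F) Bool.≟ true)

∈-shiftFamily⁻ : (U V : Subset n) (𝓕 : Family n) {G : Subset n} → G ∈ᶠ shiftFamily U V 𝓕 →
  (∃[ F ] F ∈ᶠ 𝓕 × shift U V F ≡ G) ⊎ (G ∈ᶠ 𝓕 × shift U V G ∈ᶠ 𝓕)
∈-shiftFamily⁻ U V 𝓕 {G} G∈ with anySubset? (λ F → (𝓕 F Bool.≟ true) ×-dec (shift U V F ≟ˢ G))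
... | yes F∈ = inj₁ F∈
... | no  _  with 𝓕 G
...   | true = inj₂ (refl , G∈)

∈-shiftFamily⁺ : (U V : Subset n) (𝓕 : Family n) {F : Subset n} → F ∈ᶠ 𝓕 → shift U V F ∈ᶠ shiftFamily U V 𝓕
∈-shiftFamily⁺ U V 𝓕 {F} F∈𝓕
  with anySubset? (λ F′ → (𝓕 F′ Bool.≟ true) ×-dec (shift U V F′ ≟ˢ shift U V F))
... | yes _  = refl
... | no  ¬∃ = contradiction (F , F∈𝓕 , refl) ¬∃

-- If no member is shifted out of `𝓕`, all shifted sets already lie in `𝓕`, and each member survives
-- through the second part of the union defining the shifted family.
¬Moves⇒stable : {𝓕 : Family n} (U V : Subset n) → ¬ Moves 𝓕 U V → shiftFamily U V 𝓕 ≐ 𝓕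
¬Moves⇒stable {𝓕 = 𝓕} U V ¬moves G with 𝓕 G Bool.≟ true | shiftFamily U V 𝓕 G Bool.≟ true
... | yes G∈𝓕 | yes G∈S = trans G∈S (sym G∈𝓕)
... | no  G∉𝓕 | no  G∉S = trans (Bool.¬-not G∉S) (sym (Bool.¬-not G∉𝓕))
... | yes G∈𝓕 | no  G∉S = contradiction (shift∈ G∈𝓕) λ σG∈𝓕 → G∉S (∈S σG∈𝓕)
  where
  shift∈ : ∀ {F} → F ∈ᶠ 𝓕 → shift U V F ∈ᶠ 𝓕
  shift∈ {F} F∈𝓕 with 𝓕 (shift U V F) Bool.≟ true
  ... | yes σF∈𝓕 = σF∈𝓕
  ... | no  σF∉𝓕 = contradiction (F , F∈𝓕 , σF∉𝓕) ¬moves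
  ∈S : shift U V G ∈ᶠ 𝓕 → G ∈ᶠ shiftFamily U V 𝓕
  ∈S σG∈𝓕 rewrite G∈𝓕 | σG∈𝓕 = Bool.∨-zeroʳ _
... | no  G∉𝓕 | yes G∈S with ∈-shiftFamily⁻ U V 𝓕 G∈S
...   | inj₁ (F , F∈𝓕 , refl) = contradiction (F , F∈𝓕 , G∉𝓕) ¬moves
...   | inj₂ (G∈𝓕 , _)        = contradiction G∈𝓕 G∉𝓕

Moves⇒unstable : {𝓕 : Family n} (U V : Subset n) → Moves 𝓕 U V → ¬ (shiftFamily U V 𝓕 ≐ 𝓕)
Moves⇒unstable {𝓕 = 𝓕} U V (F , F∈𝓕 , σF∉𝓕) S≐𝓕 =
  σF∉𝓕 (trans (sym (S≐𝓕 (shift U V F))) (∈-shiftFamily⁺ U V 𝓕 F∈𝓕))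

shift-⊥ : (F : Subset n) → shift ⊥ ⊥ F ≡ F
shift-⊥ F with (F ∩ (⊥ ∪ ⊥)) ≟ˢ ⊥
... | yes _ = trans (∪-identityʳ _) (p─⊥≡p F)
... | no  _ = refl

-- The condition `F ∩ (U ∪ V) ≡ V` for a real shift forces `r ∉ F`, since `r` is in `U` but not in
-- `V`; the replacement then adds all of `U`.
shift-fixed-or-gains : (U V F : Subset n) {r : Fin n} → r ∈ U → r ∉ V →
  shift U V F ≡ F ⊎ (r ∈ shift U V F × r ∉ F)
shift-fixed-or-gains U V F {r} r∈U r∉V with (F ∩ (U ∪ V)) ≟ˢ V
... | no  _  = inj₁ refl
... | yes eq = inj₂ (q⊆p∪q (F ─ V) U r∈U ,
                     λ r∈F → r∉V (subst (r ∈_) eq (x∈p∩q⁺ (r∈F , p⊆p∪q V r∈U))))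

-- A second real shift would require `r` to be absent, but the first one has put it in.
shift-idem : (U V F : Subset n) {r : Fin n} → r ∈ U → r ∉ V → shift U V (shift U V F) ≡ shift U V F
shift-idem U V F r∈U r∉V with shift-fixed-or-gains U V F r∈U r∉V
... | inj₁ σF≡F = cong (shift U V) σF≡F
... | inj₂ (r∈σF , _) with shift-fixed-or-gains U V (shift U V F) r∈U r∉V
...   | inj₁ eq         = eq
...   | inj₂ (_ , r∉σF) = contradiction r∈σF r∉σF

-- `F` meets the symmetric difference of `S` and `F` exactly in `F ─ S`, so the condition for a real
-- shift always holds.
shift-difference : (S F : Subset n) → shift (S ─ F) (F ─ S) F ≡ S
shift-difference S F with (F ∩ ((S ─ F) ∪ (F ─ S))) ≟ˢ (F ─ S)
... | yes _ = replaced S F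
  where
  replaced : ∀ {n} (S F : Subset n) → (F ─ (F ─ S)) ∪ (S ─ F) ≡ S
  replaced Vec.[] Vec.[] = refl
  replaced (inside  Vec.∷ S) (inside  Vec.∷ F) = cong (inside  Vec.∷_) (replaced S F)
  replaced (inside  Vec.∷ S) (outside Vec.∷ F) = cong (inside  Vec.∷_) (replaced S F)
  replaced (outside Vec.∷ S) (inside  Vec.∷ F) = cong (outside Vec.∷_) (replaced S F)
  replaced (outside Vec.∷ S) (outside Vec.∷ F) = cong (outside Vec.∷_) (replaced S F)
... | no ≢ = contradiction (⊆-antisym ⊆₁ ⊆₂) ≢
  where
  ⊆₁ : F ∩ ((S ─ F) ∪ (F ─ S)) ⊆ F ─ S
  ⊆₁ x∈ with x∈F , x∈∪ ← x∈p∩q⁻ F _ x∈ =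
    [ (λ x∈S─F → contradiction x∈F (x∈p─q⇒x∉q S F x∈S─F)) , (λ x∈F─S → x∈F─S) ]′ (x∈p∪q⁻ (S ─ F) (F ─ S) x∈∪)
  ⊆₂ : F ─ S ⊆ F ∩ ((S ─ F) ∪ (F ─ S))
  ⊆₂ x∈F─S = x∈p∩q⁺ (p─q⊆p F S x∈F─S , q⊆p∪q (S ─ F) (F ─ S) x∈F─S)

-- Decrease of the sum of positions

-- The shifted family is the image of `𝓕` under a map `π` that performs the shift only when the
-- result is new. A performed shift gains `r` and so strictly lowers the position by
-- `ilex-<-of-min`; this happens at least for the moved set `F₀`.
sumIlex-shiftFamily-< : {X : Subset n} {k : ℕ} {𝓕 : Family n} {r : Fin n} (U V : Subset n) →
  IsMin r X → 𝓕 ⊆ᶠ Binom X k → r ∈ U → r ∉ V → Moves 𝓕 U V →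
  sumIlex X k (shiftFamily U V 𝓕) < sumIlex X k 𝓕
sumIlex-shiftFamily-< {n} {X} {k} {𝓕} {r} U V r-min 𝓕⊆binom r∈U r∉V (F₀ , F₀∈𝓕 , σF₀∉𝓕) = begin-strict
  sum (map w (filterᵇ (shiftFamily U V 𝓕) all))  ≤⟨ sum-map-⊆ w (Unique.filter⁺ _ (allSubsets-unique n)) shifted⊆ ⟩
  sum (map w (map π (filterᵇ 𝓕 all)))            ≡⟨ cong sum (map-∘ (filterᵇ 𝓕 all)) ⟨
  sum (map (w ∘ π) (filterᵇ 𝓕 all))              <⟨ sum-map-mono-< (filterᵇ 𝓕 all) (wπ≤w ∘ ∈-filterᵇ⁻) (∈-filterᵇ⁺ F₀∈𝓕) wπF₀<wF₀ ⟩
  sum (map w (filterᵇ 𝓕 all))                    ∎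
  where
  open ℕ.≤-Reasoning
  all = allSubsets n
  w = ilex X k

  -- That π maps 𝓕 onto its shift already bounds the sum; injectivity is not needed.
  π : Subset n → Subset n
  π F = if 𝓕 (shift U V F) then F else shift U V F

  π-fixed : ∀ {F} → shift U V F ∈ᶠ 𝓕 → π F ≡ F
  π-fixed σF∈𝓕 rewrite σF∈𝓕 = refl

  π-shifted : ∀ {F} → shift U V F ∉ᶠ 𝓕 → π F ≡ shift U V F
  π-shifted σF∉𝓕 rewrite Bool.¬-not σF∉𝓕 = refl

  ∈-filterᵇ⁺ : ∀ {𝓖 : Family n} {F} → F ∈ᶠ 𝓖 → F List.∈ filterᵇ 𝓖 all
  ∈-filterᵇ⁺ F∈𝓖 = ∈-filter⁺ _ (∈-allSubsets _) (Equivalence.from Bool.T-≡ F∈𝓖)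

  ∈-filterᵇ⁻ : ∀ {𝓖 : Family n} {F} → F List.∈ filterᵇ 𝓖 all → F ∈ᶠ 𝓖
  ∈-filterᵇ⁻ F∈ = Equivalence.to Bool.T-≡ (proj₂ (∈-filter⁻ _ {xs = all} F∈))

  π-onto : ∀ {G} → G ∈ᶠ shiftFamily U V 𝓕 → ∃[ F ] F ∈ᶠ 𝓕 × G ≡ π F
  π-onto {G} G∈S with ∈-shiftFamily⁻ U V 𝓕 G∈S
  ... | inj₂ (G∈𝓕 , σG∈𝓕) = G , G∈𝓕 , sym (π-fixed σG∈𝓕)
  ... | inj₁ (F , F∈𝓕 , refl) with 𝓕 (shift U V F) Bool.≟ true
  -- A shifted set that was already in `𝓕` is its own preimage: by idempotence its shift is itself,
  -- so `π` fixes it.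
  ...   | yes σF∈𝓕 = shift U V F , σF∈𝓕 , sym (π-fixed (trans (cong 𝓕 (shift-idem U V F r∈U r∉V)) σF∈𝓕))
  ...   | no  σF∉𝓕 = F , F∈𝓕 , sym (π-shifted σF∉𝓕)

  shifted⊆ : filterᵇ (shiftFamily U V 𝓕) all List.⊆ map π (filterᵇ 𝓕 all)
  shifted⊆ G∈ with F , F∈𝓕 , refl ← π-onto (∈-filterᵇ⁻ G∈) = ∈-map⁺ π (∈-filterᵇ⁺ F∈𝓕)

  wσ<w : ∀ {F} → F ∈ᶠ 𝓕 → shift U V F ∉ᶠ 𝓕 → w (shift U V F) < w F
  wσ<w {F} F∈𝓕 σF∉𝓕 with shift-fixed-or-gains U V F r∈U r∉V
  ... | inj₁ σF≡F         = contradiction (trans (cong 𝓕 σF≡F) F∈𝓕) σF∉𝓕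
  ... | inj₂ (r∈σF , r∉F) = ilex-<-of-min r-min (𝓕⊆binom F F∈𝓕) r∈σF r∉F

  wπ≤w : ∀ {F} → F ∈ᶠ 𝓕 → w (π F) ≤ w F
  wπ≤w {F} F∈𝓕 with 𝓕 (shift U V F) Bool.≟ true
  ... | yes σF∈𝓕 = ℕ.≤-reflexive (cong w (π-fixed σF∈𝓕))
  ... | no  σF∉𝓕 = ℕ.<⇒≤ (subst (λ S → w S < w F) (sym (π-shifted σF∉𝓕)) (wσ<w F∈𝓕 σF∉𝓕))

  wπF₀<wF₀ : w (π F₀) < w F₀
  wπF₀<wF₀ = subst (λ S → w S < w F₀) (sym (π-shifted σF₀∉𝓕)) (wσ<w F₀∈𝓕 σF₀∉𝓕)

-- Minimal moving pairs and property Q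

module _ {X R : Subset n} {k : ℕ} {𝓕 : Family n} {r : Fin n}
  (r-min : IsMin r X) (r∈R : r ∈ R) (𝓕⊆binom : 𝓕 ⊆ᶠ Binom X k) (p1 : P1 X 𝓕 r R) where

  Q-of-minimal : (U V : Subset n) → U ⊆ X → V ⊆ X → U ∩ V ≡ ⊥ → ∣ U ∣ ≡ ∣ V ∣ → R ⊆ U → Moves 𝓕 U V →
    (∀ U′ V′ → U′ ⊂ U → V′ ⊂ V → ∣ U′ ∣ ≡ ∣ V′ ∣ → R ⊆ U′ → ¬ Moves 𝓕 U′ V′) →
    PropertyQ X k 𝓕 U V
  Q-of-minimal U V U⊆X V⊆X U∩V≡⊥ ∣U∣≡∣V∣ R⊆U moves minimal = record
    { U⊆X = U⊆X ; V⊆X = V⊆X ; disjoint = U∩V≡⊥ ; ∣U∣≡∣V∣ = ∣U∣≡∣V∣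
    ; U≺V = ≺-of-min r-min U⊆X V⊆X r∈U r∉V
    ; decreases = sumIlex-shiftFamily-< U V r-min 𝓕⊆binom r∈U r∉V moves
    ; stable = stable
    }
    where
    r∈U = R⊆U r∈R
    r∉V = ∉-∩⊥ U∩V≡⊥ r∈U

    stable : ∀ V′ → V′ ⊂ V → ∃[ U′ ] U′ ⊂ U × U′ ≺ V′ × ∣ U′ ∣ ≡ ∣ V′ ∣ × shiftFamily U′ V′ 𝓕 ≐ 𝓕
    stable V′ V′⊂V = by-size (nonempty? V′) (∣ R ∣ ℕ.≤? ∣ V′ ∣)
      where
      V′⊆V : V′ ⊆ V
      V′⊆V = p⊂q⇒p⊆q V′⊂V

      ∣V′∣<∣U∣ : ∣ V′ ∣ < ∣ U ∣
      ∣V′∣<∣U∣ = subst (∣ V′ ∣ <_) (sym ∣U∣≡∣V∣) (p⊂q⇒∣p∣<∣q∣ V′⊂V)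

      -- The two cases of nonempty `V′` differ only in the core `W` that `U′` has to contain, namely
      -- `R` or `⁅ r ⁆`. Either core contains `r`, which gives `U′ ≺ V′`.
      extending : (W : Subset n) → r ∈ W → W ⊆ U → ∣ W ∣ ≤ ∣ V′ ∣ →
        (∀ U′ → W ⊆ U′ → U′ ⊂ U → ∣ U′ ∣ ≡ ∣ V′ ∣ → ¬ Moves 𝓕 U′ V′) →
        ∃[ U′ ] U′ ⊂ U × U′ ≺ V′ × ∣ U′ ∣ ≡ ∣ V′ ∣ × shiftFamily U′ V′ 𝓕 ≐ 𝓕
      extending W r∈W W⊆U ∣W∣≤ ¬moves
        with U′ , W⊆U′ , U′⊆U , ∣U′∣≡ ← intermediate-subset W U ∣ V′ ∣ W⊆U ∣W∣≤ (ℕ.<⇒≤ ∣V′∣<∣U∣)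
        = U′ , U′⊂U ,
          ≺-of-min r-min (⊆-trans U′⊆U U⊆X) (⊆-trans V′⊆V V⊆X) (W⊆U′ r∈W) (r∉V ∘ V′⊆V) ,
          ∣U′∣≡ , ¬Moves⇒stable U′ V′ (¬moves U′ W⊆U′ U′⊂U ∣U′∣≡)
        where U′⊂U = ⊆∧∣∣<⇒⊂ U′⊆U (subst (_< ∣ U ∣) (sym ∣U′∣≡) ∣V′∣<∣U∣)

      by-size : Dec (Nonempty V′) → Dec (∣ R ∣ ≤ ∣ V′ ∣) →
        ∃[ U′ ] U′ ⊂ U × U′ ≺ V′ × ∣ U′ ∣ ≡ ∣ V′ ∣ × shiftFamily U′ V′ 𝓕 ≐ 𝓕
      -- An empty `U′` has no room for `r`. Here `⊥ ≺ ⊥` comes from reading inclusion as non-strict,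
      -- and the shift is the identity.
      by-size (no V′=∅) _ with refl ← Empty-unique V′=∅ =
        ⊥ , (⊥⊆ , r , r∈U , ∉⊥) , inj₁ ⊆-refl , refl ,
        ¬Moves⇒stable ⊥ ⊥ λ (F , F∈𝓕 , σF∉𝓕) → σF∉𝓕 (trans (cong 𝓕 (shift-⊥ F)) F∈𝓕)
      by-size (yes _) (yes ∣R∣≤) = extending R r∈R R⊆U ∣R∣≤
        λ U′ R⊆U′ U′⊂U ∣U′∣≡ → minimal U′ V′ U′⊂U V′⊂V ∣U′∣≡ R⊆U′
      -- Since `V′` is nonempty, `U′` can be chosen to contain `r`; if the pair moved `𝓕`, (P1)
      -- would give the excluded bound on `∣ V′ ∣`.
      by-size (yes (x , x∈V′)) (no ∣R∣≰) = extending ⁅ r ⁆ (x∈⁅x⁆ r) (⁅⁆⊆ r∈U)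
        (subst (_≤ ∣ V′ ∣) (trans (∣⁅x⁆∣≡1 x) (sym (∣⁅x⁆∣≡1 r))) (p⊆q⇒∣p∣≤∣q∣ (⁅⁆⊆ x∈V′)))
        λ U′ r⊆U′ U′⊂U ∣U′∣≡ moves′ → ∣R∣≰ (p1 U′ V′
          (⊆-trans (p⊂q⇒p⊆q U′⊂U) U⊆X) (⊆-trans V′⊆V V⊆X)
          (∩≡⊥ λ y∈U′ y∈V′ → ∉-∩⊥ U∩V≡⊥ (p⊂q⇒p⊆q U′⊂U y∈U′) (V′⊆V y∈V′))
          ∣U′∣≡ (r⊆U′ (x∈⁅x⁆ r)) (Moves⇒unstable U′ V′ moves′))
        where
        ⁅⁆⊆ : ∀ {y} {p : Subset n} → y ∈ p → ⁅ y ⁆ ⊆ p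
        ⁅⁆⊆ {y} y∈p z∈⁅y⁆ with refl ← x∈⁅y⁆⇒x≡y y z∈⁅y⁆ = y∈p

  -- Descent on `∣ U ∣`: a finite search either finds a smaller moving pair inside this one or
  -- certifies minimality. The inclusion `V₁ ⊆ V` is carried along so that whatever `V` avoids is
  -- still avoided at the end.
  Q-of-moves : (U V : Subset n) → Acc _<_ ∣ U ∣ → U ⊆ X → V ⊆ X → U ∩ V ≡ ⊥ → ∣ U ∣ ≡ ∣ V ∣ → R ⊆ U →
    Moves 𝓕 U V → ∃[ U₁ ] ∃[ V₁ ] PropertyQ X k 𝓕 U₁ V₁ × R ⊆ U₁ × V₁ ⊆ V
  Q-of-moves U V (acc smaller) U⊆X V⊆X U∩V≡⊥ ∣U∣≡∣V∣ R⊆U moves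
    with anySubset? (λ U′ → anySubset? λ V′ →
           U′ ⊂? U ×-dec V′ ⊂? V ×-dec ∣ U′ ∣ ℕ.≟ ∣ V′ ∣ ×-dec R ⊆? U′ ×-dec moves? 𝓕 U′ V′)
  ... | no  ¬smaller = U , V ,
    Q-of-minimal U V U⊆X V⊆X U∩V≡⊥ ∣U∣≡∣V∣ R⊆U moves
      (λ U′ V′ U′⊂U V′⊂V ∣U′∣≡∣V′∣ R⊆U′ moves′ → ¬smaller (U′ , V′ , U′⊂U , V′⊂V , ∣U′∣≡∣V′∣ , R⊆U′ , moves′)) ,
    R⊆U , ⊆-refl
  ... | yes (U′ , V′ , U′⊂U , V′⊂V , ∣U′∣≡∣V′∣ , R⊆U′ , moves′)
    with U₁ , V₁ , q , R⊆U₁ , V₁⊆V′ ← Q-of-moves U′ V′ (smaller (p⊂q⇒∣p∣<∣q∣ U′⊂U))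
           (⊆-trans (p⊂q⇒p⊆q U′⊂U) U⊆X) (⊆-trans (p⊂q⇒p⊆q V′⊂V) V⊆X)
           (∩≡⊥ λ y∈U′ y∈V′ → ∉-∩⊥ U∩V≡⊥ (p⊂q⇒p⊆q U′⊂U y∈U′) (p⊂q⇒p⊆q V′⊂V y∈V′))
           ∣U′∣≡∣V′∣ R⊆U′ moves′
    = U₁ , V₁ , q , R⊆U₁ , ⊆-trans V₁⊆V′ (p⊂q⇒p⊆q V′⊂V)

  -- The set `C` is `R` or `R ∪ ⁅ i ⁆` in the applications. The bound `V ⊆ F ─ C` yields every
  -- restriction on `V` in the four claims: `V` avoids what `C` contains and what `F` avoids.
  Q-of-nonFull : {C F : Subset n} → R ⊆ C → C ⊆ X → NonFull X k 𝓕 C → F ∈ᶠ 𝓕 → R ∩ F ≡ ⊥ →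
    ∃[ U ] ∃[ V ] PropertyQ X k 𝓕 U V × R ⊆ U × V ⊆ F ─ C
  Q-of-nonFull {C} {F} R⊆C C⊆X (S , S∈𝓔 , S∉𝓕) F∈𝓕 R∩F≡⊥
    with C⊆S , S⊆X , ∣S∣≡k ← 𝓔⇒Binom C⊆X S∈𝓔
    with F⊆X , ∣F∣≡k ← 𝓕⊆binom F F∈𝓕
    with U , V , q , R⊆U , V⊆F─S ← Q-of-moves (S ─ F) (F ─ S) (<-wellFounded _)
           (⊆-trans (p─q⊆p S F) S⊆X) (⊆-trans (p─q⊆p F S) F⊆X)
           (∩≡⊥ λ y∈S─F y∈F─S → x∈p─q⇒x∉q S F y∈S─F (p─q⊆p F S y∈F─S))
           (∣p∣≡∣q∣⇒∣p─q∣≡∣q─p∣ S F (trans ∣S∣≡k (sym ∣F∣≡k)))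
           (λ x∈R → x∈p∧x∉q⇒x∈p─q (C⊆S (R⊆C x∈R)) (∉-∩⊥ R∩F≡⊥ x∈R))
           (F , F∈𝓕 , λ σF∈𝓕 → S∉𝓕 (trans (cong 𝓕 (sym (shift-difference S F))) σF∈𝓕))
    = U , V , q , R⊆U , λ x∈V →
        let x∈F─S = V⊆F─S x∈V in
        x∈p∧x∉q⇒x∈p─q (p─q⊆p F S x∈F─S) (x∈p─q⇒x∉q F S x∈F─S ∘ C⊆S)

-- Choices of `C` and `F` for the four claims

lemma9p2 : (n k : ℕ) (X : Subset n) → Nonempty X →
    (𝓕 : Family n) → 𝓕 ⊆ᶠ Binom X k →
    (R T : Subset n) → R ⊆ X → T ⊆ X → ∣ R ∣ < k → ∣ T ∣ < k → R ∩ T ≡ ⊥ →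
    (r : Fin n) → IsMin r X → r ∈ R →
    (i : Fin n) → i ∈ X → i ∉ R →
    (P1 X 𝓕 r R → P2 𝓕 R → P3 X k 𝓕 R →
    ∃[ U ] ∃[ V ] PropertyQ X k 𝓕 U V × R ⊆ U)
    × (P1 X 𝓕 r R → P2 𝓕 R → P3 X k 𝓕 R → P4 X k 𝓕 R i → P5 𝓕 R i →
    ∃[ U ] ∃[ V ] PropertyQ X k 𝓕 U V × R ⊆ U × i ∉ V)
    × (P1 X 𝓕 r R → P2 𝓕 R → P3 X k 𝓕 R → P6 𝓕 R T →
    ∃[ U ] ∃[ V ] PropertyQ X k 𝓕 U V × T ∩ V ≡ ⊥ × R ⊆ U)
    × (P1 X 𝓕 r R → P2 𝓕 R → P3 X k 𝓕 R → P4 X k 𝓕 R i → P6 𝓕 R T → P7 𝓕 R T i →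
    ∃[ U ] ∃[ V ] PropertyQ X k 𝓕 U V × (T ∪ ⁅ i ⁆) ∩ V ≡ ⊥ × R ⊆ U)
lemma9p2 n k X _ 𝓕 𝓕⊆binom R T R⊆X _ _ _ _ r r-min r∈R i i∈X _ =
    (λ p1 (F , F∈𝓕 , R∩F≡⊥) p3 →
      let U , V , q , R⊆U , _ = Q-of-nonFull r-min r∈R 𝓕⊆binom p1 ⊆-refl R⊆X p3 F∈𝓕 R∩F≡⊥
      in U , V , q , R⊆U)
  -- With `C` equal to `R ∪ ⁅ i ⁆`, the element `i` lies in `C` and hence outside `V`.
  , (λ p1 _ _ p4 (F , F∈𝓕 , R∩F≡⊥ , _) →
      let U , V , q , R⊆U , V⊆ = Q-of-nonFull r-min r∈R 𝓕⊆binom p1 (p⊆p∪q ⁅ i ⁆) R∪i⊆X p4 F∈𝓕 R∩F≡⊥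
      in U , V , q , R⊆U , λ i∈V → x∈p─q⇒x∉q F (R ∪ ⁅ i ⁆) (V⊆ i∈V) i∈R∪i)
  -- Here `T` is kept out of `V` by the choice of `F`, which avoids `T`.
  , (λ p1 _ p3 (F , F∈𝓕 , RT∩F≡⊥) →
      let U , V , q , R⊆U , V⊆ = Q-of-nonFull r-min r∈R 𝓕⊆binom p1 ⊆-refl R⊆X p3 F∈𝓕 (R∩≡⊥ RT∩F≡⊥)
      in U , V , q ,
         ∩≡⊥ (λ x∈T x∈V → ∉-∩⊥ RT∩F≡⊥ (q⊆p∪q R T x∈T) (p─q⊆p F R (V⊆ x∈V))) ,
         R⊆U)
  -- Both devices combined: `F` keeps `T` out of `V`, and `C` keeps `i` out.
  , (λ p1 _ _ p4 (F , F∈𝓕 , RT∩F≡⊥) _ →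
      let U , V , q , R⊆U , V⊆ = Q-of-nonFull r-min r∈R 𝓕⊆binom p1 (p⊆p∪q ⁅ i ⁆) R∪i⊆X p4 F∈𝓕 (R∩≡⊥ RT∩F≡⊥)
      in U , V , q ,
         ∩≡⊥ (λ x∈T∪i x∈V →
           [ (λ x∈T → ∉-∩⊥ RT∩F≡⊥ (q⊆p∪q R T x∈T) (p─q⊆p F (R ∪ ⁅ i ⁆) (V⊆ x∈V)))
           , (λ x∈i → x∈p─q⇒x∉q F (R ∪ ⁅ i ⁆) (V⊆ x∈V) (q⊆p∪q R ⁅ i ⁆ x∈i))
           ]′ (x∈p∪q⁻ T ⁅ i ⁆ x∈T∪i)) ,
         R⊆U)
  where
  i∈R∪i : i ∈ R ∪ ⁅ i ⁆
  i∈R∪i = q⊆p∪q R ⁅ i ⁆ (x∈⁅x⁆ i)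

  R∪i⊆X : R ∪ ⁅ i ⁆ ⊆ X
  R∪i⊆X x∈ with x∈p∪q⁻ R ⁅ i ⁆ x∈
  ... | inj₁ x∈R = R⊆X x∈R
  ... | inj₂ x∈i with refl ← x∈⁅y⁆⇒x≡y i x∈i = i∈X

  R∩≡⊥ : ∀ {F} → (R ∪ T) ∩ F ≡ ⊥ → R ∩ F ≡ ⊥
  R∩≡⊥ RT∩F≡⊥ = ∩≡⊥ λ x∈R → ∉-∩⊥ RT∩F≡⊥ (p⊆p∪q T x∈R)
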